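{- For every trace of the protocol model (i.e. every trace in $[\![\mathsf{O}\parallel\mathsf{R}\parallel\mathsf{TTP}\parallel \mathrm{Sc}]\!]$), if the trace satisfies $\varphi_{\mathsf O}\wedge\varphi_{\mathsf R}\wedge\varphi_{\mathsf{TTP}}$, then it satisfies the fairness objective $\varphi_f=\Box(\mathrm{NRO}\Rightarrow\Diamond\,\mathrm{NRR})\wedge\Box(\mathrm{NRR}\Rightarrow\Diamond\,\mathrm{NRO})$. In short, $\varphi_{\mathsf O}\wedge\varphi_{\mathsf R}\wedge\varphi_{\mathsf{TTP}}\Rightarrow\varphi_f$.
   Context: **Protocol model.** There are three processes: the originator $\mathsf O$, the recipient $\mathsf R$ and the trusted third party $\mathsf{TTP}$. Messages: $\mathsf O$ may send $m_1,m_3$ to $\mathsf R$ and $a_1^{\mathsf O}$ (abort request), $r_1^{\mathsf O}$ (resolve request) to $\mathsf{TTP}$; $\mathsf R$ may send $m_2,m_4$ to $\mathsf O$ and $r_1^{\mathsf R}$ (resolve request) to $\mathsf{TTP}$; $\mathsf{TTP}$ may send $a_2^{\mathsf O}$ (abort token) or $r_2^{\mathsf O}$ (replacement for $\mathsf R$'s signature) to $\mathsf O$, and $a_2^{\mathsf R}$ (abort token) or $r_2^{\mathsf R}$ (replacement for $\mathsf O$'s signature) to $\mathsf R$. Each process, when scheduled, chooses a move: the idle move $\iota$ or sending a message it is able to compose; the $\mathsf{TTP}$ also has the moves $[a_2^{\mathsf O},a_2^{\mathsf R}]$ and $[r_2^{\mathsf O},r_2^{\mathsf R}]$, each sending both listed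 messages (in some order). Composability: $\mathsf R$ can send $m_2$ only after receiving $m_1$; $\mathsf O$ can send $m_3$ only after receiving $m_2$; $\mathsf R$ can send $m_4$ only after receiving $m_3$; $\mathsf O$ can send $r_1^{\mathsf O}$ only after receiving $m_2$; $\mathsf R$ can send $r_1^{\mathsf R}$ only after receiving $m_1$; $\mathsf O$ can send $m_1$ and $a_1^{\mathsf O}$ from the start. The $\mathsf{TTP}$ is *reasonable*: it never sends a message unless it has received an abort or resolve request; it processes messages first-in-first-out; if the first request received is an abort request it eventually sends an abort token; if the first request received is a resolve request it eventually sends an agent signature. **Predicates** (Boolean variables, initially false, monotonic: once true they stay true). Set by $\mathsf O$: $M_1$, $M_3$, $\mathrm{ABR}^{\mathsf O}$, $\mathrm{RES}^{\mathsf O}$ on sending $m_1,m_3,a_1^{\mathsf O},r_1^{\mathsf O}$; $\mathrm{EOR}$ on receiving $m_2$ or $r_2^{\mathsf O}$; $\mathrm{Sig}_{\mathsf R}^{\mathsf R}$ on receiving $m_4$; $\mathrm{Sig}_{\mathsf R}^{\mathsf{TTP}}$ on receiving $r_2^{\mathsf O}$; $\mathrm{AB}_{\mathsf O}$ on receiving $a_2^{\mathsf O}$. Set by $\mathsf R$: $M_2,M_4,\mathrm{RES}^{\mathsf R}$ on sending $m_2,m_4,r_1^{\mathsf R}$; $\mathrm{EOO}$ on receiving $m_1$ or $r_2^{\mathsf R}$; $\mathrm{Sig}_{\mathsf O}^{\mathsf O}$ on receiving $m_3$; $\mathrm{Sig}_{\mathsf O}^{\mathsf{TTP}}$ on receiving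 $r_2^{\mathsf R}$; $\mathrm{AB}_{\mathsf R}$ on receiving $a_2^{\mathsf R}$. Set by $\mathsf{TTP}$: $\mathrm{ABR}$ on receiving $a_1^{\mathsf O}$; $\mathrm{RES}$ on receiving $r_1^{\mathsf O}$ or $r_1^{\mathsf R}$; $A_2^{\mathsf O},A_2^{\mathsf R},R_2^{\mathsf O},R_2^{\mathsf R}$ on sending $a_2^{\mathsf O},a_2^{\mathsf R},r_2^{\mathsf O},r_2^{\mathsf R}$. A state is a valuation of all these variables. **Traces.** Channels between $\mathsf O$ and $\mathsf R$ are unreliable (messages may never be delivered); channels between each agent and the $\mathsf{TTP}$ are resilient (every message is eventually delivered, without a fixed bound and possibly out of order). A scheduler assigns turns to the processes as a function of the history; it is fair if every process gets infinitely many turns. $[\![\mathsf O\parallel\mathsf R\parallel\mathsf{TTP}\parallel\mathrm{Sc}]\!]$ denotes the set of infinite sequences of valuations, starting from the all-false valuation, generated by the processes under fair schedulers $\mathrm{Sc}$ and all allowed channel behaviours. **Objectives** (LTL path formulas; $\Box$ = always, $\Diamond$ = eventually): - $\mathrm{NRO}=\mathrm{EOO}\wedge(\mathrm{Sig}_{\mathsf O}^{\mathsf O}\vee\mathrm{Sig}_{\mathsf O}^{\mathsf{TTP}})$, $\mathrm{NRR}=\mathrm{EOR}\wedge(\mathrm{Sig}_{\mathsf R}^{\mathsf R}\vee\mathrm{Sig}_{\mathsf R}^{\mathsf{TTP}})$. - $\varphi_{\mathsf O}=\Diamond M_1\wedge\Box\big[(\Diamond\mathrm{Sig}_{\mathsf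 R}^{\mathsf R}\vee(\Diamond\mathrm{Sig}_{\mathsf R}^{\mathsf{TTP}}\wedge\Box\neg\mathrm{AB}_{\mathsf O}))\vee(\Diamond\mathrm{AB}_{\mathsf O}\wedge\Box(\neg\mathrm{Sig}_{\mathsf O}^{\mathsf O}\wedge\neg\mathrm{Sig}_{\mathsf O}^{\mathsf{TTP}}))\big]$. - $\varphi_{\mathsf R}=\Box\big[\mathrm{EOO}\Rightarrow\big((\Diamond\mathrm{Sig}_{\mathsf O}^{\mathsf O}\vee(\Diamond\mathrm{Sig}_{\mathsf O}^{\mathsf{TTP}}\wedge\Box\neg\mathrm{AB}_{\mathsf R}))\vee(\Diamond\mathrm{AB}_{\mathsf R}\wedge\Box(\neg\mathrm{Sig}_{\mathsf R}^{\mathsf R}\wedge\neg\mathrm{Sig}_{\mathsf R}^{\mathsf{TTP}}))\big)\big]$. - $\varphi_{\mathsf{TTP}}$ is the conjunction of: $\Box((\mathrm{ABR}\vee\mathrm{RES})\Rightarrow(\Diamond\mathrm{AB}_{\mathsf O}\vee\Diamond\mathrm{AB}_{\mathsf R}\vee\Diamond\mathrm{Sig}_{\mathsf O}^{\mathsf{TTP}}\vee\Diamond\mathrm{Sig}_{\mathsf R}^{\mathsf{TTP}}))$; $\Box(\mathrm{Sig}_{\mathsf O}^{\mathsf{TTP}}\Rightarrow(\Diamond\mathrm{Sig}_{\mathsf R}^{\mathsf{TTP}}\wedge\Box(\neg\mathrm{AB}_{\mathsf O}\wedge\neg\mathrm{AB}_{\mathsf R})))$; $\Box(\mathrm{Sig}_{\mathsf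 R}^{\mathsf{TTP}}\Rightarrow(\Diamond\mathrm{Sig}_{\mathsf O}^{\mathsf{TTP}}\wedge\Box(\neg\mathrm{AB}_{\mathsf O}\wedge\neg\mathrm{AB}_{\mathsf R})))$; $\Box(\mathrm{AB}_{\mathsf O}\Rightarrow(\Diamond\mathrm{AB}_{\mathsf R}\wedge\Box(\neg\mathrm{Sig}_{\mathsf O}^{\mathsf{TTP}}\wedge\neg\mathrm{Sig}_{\mathsf R}^{\mathsf{TTP}})))$; $\Box(\mathrm{AB}_{\mathsf R}\Rightarrow(\Diamond\mathrm{AB}_{\mathsf O}\wedge\Box(\neg\mathrm{Sig}_{\mathsf O}^{\mathsf{TTP}}\wedge\neg\mathrm{Sig}_{\mathsf R}^{\mathsf{TTP}})))$. -}

module Defs where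

open import Data.Bool.Base using (Bool; true; false) renaming (_∨_ to _or_)
open import Data.List.Base using (List; []; _∷_; _++_; _∷ʳ_; head; take; drop; applyUpTo)
open import Data.List.Membership.Propositional using (_∈_)
open import Data.List.Relation.Unary.All using (All)
open import Data.List.Relation.Unary.Any using (_─_)
open import Data.Maybe.Base using (just)
open import Data.Nat.Base using (ℕ; zero; suc; _+_; _≤_)
open import Data.Product.Base using (Σ; _×_; _,_; ∃-syntax)
open import Data.Sum.Base using (_⊎_)
open import Data.Unit.Base using (⊤)
open import Relation.Binary.PropositionalEquality.Core using (_≡_; _≢_)
import Relation.Nullary.Negation.Core as Neg

data Process : Set where
  O R TTP : Process

-- The superscript of a TTP message names the agent concerned: the requester
-- for r₁, the addressee for a₂ and r₂.
data Message : Set where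
  m₁ m₂ m₃ m₄ : Message
  a₁ᴼ r₁ᴼ r₁ᴿ : Message
  a₂ᴼ a₂ᴿ r₂ᴼ r₂ᴿ : Message

sender : Message → Process
sender m₁  = O
sender m₂  = R
sender m₃  = O
sender m₄  = R
sender a₁ᴼ = O
sender r₁ᴼ = O
sender r₁ᴿ = R
sender a₂ᴼ = TTP
sender a₂ᴿ = TTP
sender r₂ᴼ = TTP
sender r₂ᴿ = TTP

receiver : Message → Process
receiver m₁  = R
receiver m₂  = O
receiver m₃  = R
receiver m₄  = O
receiver a₁ᴼ = TTP
receiver r₁ᴼ = TTP
receiver r₁ᴿ = TTP
receiver a₂ᴼ = O
receiver a₂ᴿ = R
receiver r₂ᴼ = O
receiver r₂ᴿ = R

-- SigX⟨Y⟩ : the signature of X, obtained from Y.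
data Var : Set where
  M₁ M₃ ABRᴼ RESᴼ EOR SigR⟨R⟩ SigR⟨TTP⟩ AB-O : Var
  M₂ M₄ RESᴿ EOO SigO⟨O⟩ SigO⟨TTP⟩ AB-R : Var
  ABR RES A₂ᴼ A₂ᴿ R₂ᴼ R₂ᴿ : Var

Valuation : Set
Valuation = Var → Bool

setBySending : Message → Valuation
setBySending m₁  M₁   = true
setBySending m₂  M₂   = true
setBySending m₃  M₃   = true
setBySending m₄  M₄   = true
setBySending a₁ᴼ ABRᴼ = true
setBySending r₁ᴼ RESᴼ = true
setBySending r₁ᴿ RESᴿ = true
setBySending a₂ᴼ A₂ᴼ  = true
setBySending a₂ᴿ A₂ᴿ  = true
setBySending r₂ᴼ R₂ᴼ  = true
setBySending r₂ᴿ R₂ᴿ  = true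
setBySending _   _    = false

setByReceiving : Message → Valuation
setByReceiving m₁  EOO       = true
setByReceiving m₂  EOR       = true
setByReceiving m₃  SigO⟨O⟩   = true
setByReceiving m₄  SigR⟨R⟩   = true
setByReceiving a₁ᴼ ABR       = true
setByReceiving r₁ᴼ RES       = true
setByReceiving r₁ᴿ RES       = true
setByReceiving a₂ᴼ AB-O      = true
setByReceiving a₂ᴿ AB-R      = true
setByReceiving r₂ᴼ EOR       = true
setByReceiving r₂ᴼ SigR⟨TTP⟩ = true
setByReceiving r₂ᴿ EOO       = true
setByReceiving r₂ᴿ SigO⟨TTP⟩ = true
setByReceiving _   _         = false

-- A message in a channel, stamped with the number of the round it was sent in,
-- so that copies of the same message sent in different rounds stay distinct.
Packet : Set
Packet = Message × ℕ

record Config : Set where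
  field
    val      : Valuation
    flight   : List Packet
    received : List Message   -- everything delivered so far, to any process
    inbox    : List Message   -- requests awaiting the TTP, oldest first
    handled  : List Message   -- requests the TTP has processed, oldest first

open Config public

initial : Config
initial = record
  { val = λ _ → false ; flight = [] ; received = [] ; inbox = [] ; handled = [] }

-- The TTP processes requests first-in-first-out: the k oldest ones leave the inbox.
handle : ℕ → Config → Config
handle k c = record c
  { inbox = drop k (inbox c) ; handled = handled c ++ take k (inbox c) }

-- By the FIFO discipline, handled c ++ inbox c lists all requests the TTP has
-- received in their order of arrival.
FirstRequest : Config → Message → Set
FirstRequest c m = head (handled c ++ inbox c) ≡ just m

send : ℕ → Message → Config → Config
send n m c = record c
  { val = λ x → setBySending m x or val c x ; flight = flight c ∷ʳ (m , n) }

sendAll : ℕ → List Message → Config → Config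
sendAll n []       c = c
sendAll n (m ∷ ms) c = sendAll n ms (send n m c)

enqueue : Process → Message → List Message → List Message
enqueue TTP m ms = ms ∷ʳ m
enqueue _   _ ms = ms

receive : Message → Config → Config
receive m c = record c
  { val      = λ x → setByReceiving m x or val c x
  ; received = received c ∷ʳ m
  ; inbox    = enqueue (receiver m) m (inbox c)
  }

infix 4 _—[_]↠_

-- Packets are picked from the channels in any order; one that is never picked
-- is never delivered.
data _—[_]↠_ : Config → List Packet → Config → Set where
  done    : ∀ {c} → c —[ [] ]↠ c
  deliver : ∀ {c c′ m n pks} (i : (m , n) ∈ flight c) →
            receive m (record c { flight = flight c ─ i }) —[ pks ]↠ c′ →
            c —[ (m , n) ∷ pks ]↠ c′

-- p Plays ms : p has a move sending exactly ms, in this order.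
data _Plays_ : Process → List Message → Set where
  ι         : ∀ {p} → p Plays []
  [_]       : ∀ m → sender m Plays (m ∷ [])
  [a₂ᴼ,a₂ᴿ] : TTP Plays (a₂ᴼ ∷ a₂ᴿ ∷ [])
  [a₂ᴿ,a₂ᴼ] : TTP Plays (a₂ᴿ ∷ a₂ᴼ ∷ [])
  [r₂ᴼ,r₂ᴿ] : TTP Plays (r₂ᴼ ∷ r₂ᴿ ∷ [])
  [r₂ᴿ,r₂ᴼ] : TTP Plays (r₂ᴿ ∷ r₂ᴼ ∷ [])

-- The TTP may process requests at the start of the very turn in which it sends,
-- so asking for a processed request rather than merely a received one excludes
-- no trace.
Composable : Config → Message → Set
Composable c m₁  = ⊤
Composable c m₂  = m₁ ∈ received c
Composable c m₃  = m₂ ∈ received c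
Composable c m₄  = m₃ ∈ received c
Composable c a₁ᴼ = ⊤
Composable c r₁ᴼ = m₂ ∈ received c
Composable c r₁ᴿ = m₁ ∈ received c
Composable c a₂ᴼ = handled c ≢ []
Composable c a₂ᴿ = handled c ≢ []
Composable c r₂ᴼ = handled c ≢ []
Composable c r₂ᴿ = handled c ≢ []

-- Round n, in which p has its turn: p moves, sending ms, and then the channels
-- deliver pks.
record Round (n : ℕ) (p : Process) (c : Config) (ms : List Message)
             (pks : List Packet) (c′ : Config) : Set where
  field
    processed  : ℕ
    only-TTP   : p ≢ TTP → processed ≡ 0
    move       : p Plays ms
    composable : All (Composable (handle processed c)) ms
    delivery   : sendAll n ms (handle processed c) —[ pks ]↠ c′

Trace : Set
Trace = ℕ → Valuation

Scheduler : Set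
Scheduler = List Valuation → Process

turn : Scheduler → Trace → ℕ → Process
turn Sc σ n = Sc (applyUpTo σ (suc n))

Fair : Scheduler → Set
Fair Sc = ∀ (σ : Trace) (p : Process) (n : ℕ) → ∃[ m ] (n ≤ m × turn Sc σ m ≡ p)

-- The channels joining an agent and the TTP.
OnResilientChannel : Message → Set
OnResilientChannel m = sender m ≡ TTP ⊎ receiver m ≡ TTP

record Run (Sc : Scheduler) : Set where
  field
    config    : ℕ → Config
    sent      : ℕ → List Message
    delivered : ℕ → List Packet

    start : config 0 ≡ initial
    round : ∀ n → Round n (turn Sc (λ i → val (config i)) n)
                        (config n) (sent n) (delivered n) (config (suc n))

    resilient : ∀ n m s → OnResilientChannel m → (m , s) ∈ flight (config n) →
                ∃[ k ] (n ≤ k × (m , s) ∈ delivered k)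

    -- Since the TTP sends nothing before its first request, the round k below
    -- necessarily comes after that request.
    reasonable-abort : ∀ n → FirstRequest (config n) a₁ᴼ →
                       ∃[ k ] (a₂ᴼ ∈ sent k ⊎ a₂ᴿ ∈ sent k)
    reasonable-resolve : ∀ n →
                         FirstRequest (config n) r₁ᴼ ⊎ FirstRequest (config n) r₁ᴿ →
                         ∃[ k ] (r₂ᴼ ∈ sent k ⊎ r₂ᴿ ∈ sent k)

  valuations : Trace
  valuations n = val (config n)

⟦O∥R∥TTP∥_⟧ : Scheduler → Trace → Set
⟦O∥R∥TTP∥ Sc ⟧ σ = Σ (Run Sc) λ ρ → ∀ n x → σ n x ≡ Run.valuations ρ n x

infix  9 ⟨_⟩
infix  8 ¬_ □_ ◇_
infixr 6 _∧_
infixr 5 _∨_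
infixr 4 _⇒_

data LTL : Set where
  ⟨_⟩         : Var → LTL
  ¬_ □_ ◇_    : LTL → LTL
  _∧_ _∨_ _⇒_ : LTL → LTL → LTL

suffix : ℕ → Trace → Trace
suffix n σ i = σ (n + i)

infix 3 _⊨_

_⊨_ : Trace → LTL → Set
σ ⊨ ⟨ x ⟩   = σ 0 x ≡ true
σ ⊨ ¬ φ     = Neg.¬ (σ ⊨ φ)
σ ⊨ φ ∧ ψ   = (σ ⊨ φ) × (σ ⊨ ψ)
σ ⊨ φ ∨ ψ   = (σ ⊨ φ) ⊎ (σ ⊨ ψ)
σ ⊨ φ ⇒ ψ   = σ ⊨ φ → σ ⊨ ψ
σ ⊨ □ φ     = ∀ n → suffix n σ ⊨ φ
σ ⊨ ◇ φ     = ∃[ n ] (suffix n σ ⊨ φ)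

NRO NRR : LTL
NRO = ⟨ EOO ⟩ ∧ (⟨ SigO⟨O⟩ ⟩ ∨ ⟨ SigO⟨TTP⟩ ⟩)
NRR = ⟨ EOR ⟩ ∧ (⟨ SigR⟨R⟩ ⟩ ∨ ⟨ SigR⟨TTP⟩ ⟩)

φ-O φ-R φ-TTP φ-f : LTL

φ-O = ◇ ⟨ M₁ ⟩
    ∧ □ ( (◇ ⟨ SigR⟨R⟩ ⟩ ∨ (◇ ⟨ SigR⟨TTP⟩ ⟩ ∧ □ ¬ ⟨ AB-O ⟩))
        ∨ (◇ ⟨ AB-O ⟩ ∧ □ (¬ ⟨ SigO⟨O⟩ ⟩ ∧ ¬ ⟨ SigO⟨TTP⟩ ⟩)))

φ-R = □ ( ⟨ EOO ⟩
        ⇒ ( (◇ ⟨ SigO⟨O⟩ ⟩ ∨ (◇ ⟨ SigO⟨TTP⟩ ⟩ ∧ □ ¬ ⟨ AB-R ⟩))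
          ∨ (◇ ⟨ AB-R ⟩ ∧ □ (¬ ⟨ SigR⟨R⟩ ⟩ ∧ ¬ ⟨ SigR⟨TTP⟩ ⟩))))

φ-TTP = □ ( ⟨ ABR ⟩ ∨ ⟨ RES ⟩
          ⇒ ◇ ⟨ AB-O ⟩ ∨ ◇ ⟨ AB-R ⟩ ∨ ◇ ⟨ SigO⟨TTP⟩ ⟩ ∨ ◇ ⟨ SigR⟨TTP⟩ ⟩)
      ∧ □ (⟨ SigO⟨TTP⟩ ⟩ ⇒ ◇ ⟨ SigR⟨TTP⟩ ⟩ ∧ □ (¬ ⟨ AB-O ⟩ ∧ ¬ ⟨ AB-R ⟩))
      ∧ □ (⟨ SigR⟨TTP⟩ ⟩ ⇒ ◇ ⟨ SigO⟨TTP⟩ ⟩ ∧ □ (¬ ⟨ AB-O ⟩ ∧ ¬ ⟨ AB-R ⟩))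
      ∧ □ (⟨ AB-O ⟩ ⇒ ◇ ⟨ AB-R ⟩ ∧ □ (¬ ⟨ SigO⟨TTP⟩ ⟩ ∧ ¬ ⟨ SigR⟨TTP⟩ ⟩))
      ∧ □ (⟨ AB-R ⟩ ⇒ ◇ ⟨ AB-O ⟩ ∧ □ (¬ ⟨ SigO⟨TTP⟩ ⟩ ∧ ¬ ⟨ SigR⟨TTP⟩ ⟩))

φ-f = □ (NRO ⇒ ◇ NRR) ∧ □ (NRR ⇒ ◇ NRO)

{-# OPTIONS --safe #-}

-- Each of m₂, m₃, m₄ is sent only after the previous message was received, so
-- once m₄ has been received, so have m₁, m₂ and m₃. Thus SigR⟨R⟩ entails EOR, EOO
-- and SigO⟨O⟩, while a signature replaced by the TTP carries its own evidence.
-- Given NRO, φ-O yields NRR, as its abort alternative is incompatible with NRO.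
-- Given NRR, either SigR⟨R⟩ yields NRO at once, or φ-TTP provides SigO⟨TTP⟩.
module Submission where

open import Defs

open import Data.Bool.Base using (true; false) renaming (_∨_ to _or_)
open import Data.Bool.Properties using (∨-zeroʳ)
open import Data.Empty using (⊥-elim)
open import Data.List.Base using (List; []; _∷_; _∷ʳ_)
open import Data.List.Membership.Propositional using (_∈_)
open import Data.List.Membership.Propositional.Properties using (∈-++⁺ˡ)
open import Data.List.Relation.Unary.All as All using (All; []; _∷_)
open import Data.List.Relation.Unary.All.Properties using (─⁺; ∷ʳ⁺)
open import Data.List.Relation.Unary.Any as Any using (Any; here)
open import Data.List.Relation.Unary.Any.Properties using (++⁺ˡ; ++⁺ʳ; ++⁻)
open import Data.Nat.Base using (zero; suc)
open import Data.Product.Base using (_,_; proj₁; proj₂)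
open import Data.Sum.Base using (_⊎_; inj₁; inj₂)
open import Function.Base using (_∘_)
open import Relation.Binary.PropositionalEquality using (_≡_; refl; sym; trans; subst; cong)

∨-true⁻ : ∀ a {b} → a or b ≡ true → a ≡ true ⊎ b ≡ true
∨-true⁻ true  _ = inj₁ refl
∨-true⁻ false p = inj₂ p

infix 4 _Needs_

data _Needs_ : Message → Message → Set where
  m₂-needs-m₁ : m₂ Needs m₁
  m₃-needs-m₂ : m₃ Needs m₂
  m₄-needs-m₃ : m₄ Needs m₃

-- Phrased over the list of received messages alone: it is monotone in `ms`, and neither sending nor
-- handling requests can affect it.
Supported : List Message → Message → Set
Supported ms m = ∀ {k} → m Needs k → k ∈ ms

composable⇒supported : ∀ {c} m → Composable c m → Supported (received c) m
composable⇒supported _ p m₂-needs-m₁ = p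
composable⇒supported _ p m₃-needs-m₂ = p
composable⇒supported _ p m₄-needs-m₃ = p

-- Singles out the variables whose truth can be traced back to a delivery: no `send` can turn one
-- on.
SetOnlyByReceiving : Var → Set
SetOnlyByReceiving x = ∀ m → setBySending m x ≡ false

_Sets_ : Message → Var → Set
m Sets x = setByReceiving m x ≡ true

-- `flight-supported` makes `received-supported` inductive: support is established at sending and
-- must outlast the time in the channel. Together, the last two fields let an implication between
-- variables be proved by passing through received messages.
record Invariant (c : Config) : Set where
  field
    flight-supported   : All (Supported (received c) ∘ proj₁) (flight c)
    received-supported : All (Supported (received c)) (received c)
    received⇒val       : ∀ {x} → Any (_Sets x) (received c) → val c x ≡ true
    val⇒received       : ∀ {x} → SetOnlyByReceiving x →
                         val c x ≡ true → Any (_Sets x) (received c)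

open Invariant

invariant-initial : Invariant initial
invariant-initial = record
  { flight-supported   = []
  ; received-supported = []
  ; received⇒val       = λ ()
  ; val⇒received       = λ _ ()
  }

invariant-handle : ∀ {c} k → Invariant c → Invariant (handle k c)
invariant-handle _ inv = record
  { flight-supported   = flight-supported inv
  ; received-supported = received-supported inv
  ; received⇒val       = received⇒val inv
  ; val⇒received       = val⇒received inv
  }

invariant-send : ∀ {c} n m → Supported (received c) m →
                 Invariant c → Invariant (send n m c)
invariant-send {c} n m supported inv = record
  { flight-supported   = ∷ʳ⁺ (flight-supported inv) supported
  ; received-supported = received-supported inv
  ; received⇒val       = λ {x} p → trans (cong (setBySending m x or_) (received⇒val inv p))
                                         (∨-zeroʳ (setBySending m x))
  ; val⇒received       = λ {x} only p →
      val⇒received inv only (subst (λ b → b or val c x ≡ true) (only m) p)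
  }

invariant-sendAll : ∀ {c} n ms → All (Supported (received c)) ms →
                    Invariant c → Invariant (sendAll n ms c)
invariant-sendAll n []       []       inv = inv
invariant-sendAll n (m ∷ ms) (s ∷ ss) inv =
  -- `send` leaves `received` unchanged, so `ss` still applies after `m` has been sent.
  invariant-sendAll n ms ss (invariant-send n m s inv)

-- The delivered message brings its support along from the channel; every other support merely
-- widens to the longer list.
invariant-receive : ∀ {c m n} (i : (m , n) ∈ flight c) → Invariant c →
                    Invariant (receive m (record c { flight = flight c Any.─ i }))
invariant-receive {c} {m} {n} i inv = record
  { flight-supported   = All.map widen (─⁺ i (flight-supported inv))
  ; received-supported = ∷ʳ⁺ (All.map widen (received-supported inv))
                             (widen (All.lookup (flight-supported inv) i))
  ; received⇒val       = λ p → val-after (++⁻ (received c) p)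
  ; val⇒received       = λ {x} only p → received-after only (∨-true⁻ (setByReceiving m x) p)
  }
  where
  widen : ∀ {k} → Supported (received c) k → Supported (received c ∷ʳ m) k
  widen s needs = ∈-++⁺ˡ (s needs)

  val-after : ∀ {x} → Any (_Sets x) (received c) ⊎ Any (_Sets x) (m ∷ []) →
              setByReceiving m x or val c x ≡ true
  val-after {x} (inj₁ p)        = trans (cong (setByReceiving m x or_) (received⇒val inv p))
                                        (∨-zeroʳ (setByReceiving m x))
  val-after {x} (inj₂ (here p)) = cong (_or val c x) p

  received-after : ∀ {x} → SetOnlyByReceiving x → m Sets x ⊎ val c x ≡ true →
                   Any (_Sets x) (received c ∷ʳ m)
  received-after _    (inj₁ p) = ++⁺ʳ (received c) (here p)
  received-after only (inj₂ p) = ++⁺ˡ (val⇒received inv only p)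

invariant-delivery : ∀ {c pks c′} → c —[ pks ]↠ c′ → Invariant c → Invariant c′
invariant-delivery done          inv = inv
invariant-delivery (deliver i d) inv = invariant-delivery d (invariant-receive i inv)

invariant-round : ∀ {n p c ms pks c′} → Round n p c ms pks c′ →
                  Invariant c → Invariant c′
invariant-round {n} {c = c} {ms} r inv =
  invariant-delivery delivery
    (invariant-sendAll n ms
      -- Composability is judged after handling, but `handle` keeps `received`, so this is support
      -- relative to `c` itself.
      (All.map (λ {m} → composable⇒supported {handle processed c} m) composable)
      (invariant-handle processed inv))
  where open Round r

invariant-run : ∀ {Sc} (ρ : Run Sc) n → Invariant (Run.config ρ n)
invariant-run ρ zero    = subst Invariant (sym (Run.start ρ)) invariant-initial
invariant-run ρ (suc n) = invariant-round (Run.round ρ n) (invariant-run ρ n)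

module _ {c : Config} (inv : Invariant c) where

  needs⇒received : ∀ {m k} → m Needs k → m ∈ received c → k ∈ received c
  needs⇒received needs p = All.lookup (received-supported inv) p needs

  received-sets : ∀ {m x} → m Sets x → m ∈ received c → val c x ≡ true
  received-sets s = received⇒val inv ∘ Any.map λ { refl → s }

  SigR⟨R⟩⇒m₄ : val c SigR⟨R⟩ ≡ true → m₄ ∈ received c
  -- For every message other than `m₄`, the hypothesis computes to `false ≡ true`. The table below
  -- checks that no sending sets the variable.
  SigR⟨R⟩⇒m₄ = Any.map (λ { {m₄} refl → refl }) ∘ val⇒received inv
    λ { m₁ → refl ; m₂ → refl ; m₃ → refl ; m₄ → refl ; a₁ᴼ → refl ; r₁ᴼ → refl
      ; r₁ᴿ → refl ; a₂ᴼ → refl ; a₂ᴿ → refl ; r₂ᴼ → refl ; r₂ᴿ → refl }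

  SigR⟨TTP⟩⇒r₂ᴼ : val c SigR⟨TTP⟩ ≡ true → r₂ᴼ ∈ received c
  SigR⟨TTP⟩⇒r₂ᴼ = Any.map (λ { {r₂ᴼ} refl → refl }) ∘ val⇒received inv
    λ { m₁ → refl ; m₂ → refl ; m₃ → refl ; m₄ → refl ; a₁ᴼ → refl ; r₁ᴼ → refl
      ; r₁ᴿ → refl ; a₂ᴼ → refl ; a₂ᴿ → refl ; r₂ᴼ → refl ; r₂ᴿ → refl }

  SigO⟨TTP⟩⇒r₂ᴿ : val c SigO⟨TTP⟩ ≡ true → r₂ᴿ ∈ received c
  SigO⟨TTP⟩⇒r₂ᴿ = Any.map (λ { {r₂ᴿ} refl → refl }) ∘ val⇒received inv
    λ { m₁ → refl ; m₂ → refl ; m₃ → refl ; m₄ → refl ; a₁ᴼ → refl ; r₁ᴼ → refl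
      ; r₁ᴿ → refl ; a₂ᴼ → refl ; a₂ᴿ → refl ; r₂ᴼ → refl ; r₂ᴿ → refl }

  SigR⟨R⟩⇒m₃ : val c SigR⟨R⟩ ≡ true → m₃ ∈ received c
  SigR⟨R⟩⇒m₃ = needs⇒received m₄-needs-m₃ ∘ SigR⟨R⟩⇒m₄

  SigR⟨R⟩⇒m₂ : val c SigR⟨R⟩ ≡ true → m₂ ∈ received c
  SigR⟨R⟩⇒m₂ = needs⇒received m₃-needs-m₂ ∘ SigR⟨R⟩⇒m₃

  SigR⟨R⟩⇒m₁ : val c SigR⟨R⟩ ≡ true → m₁ ∈ received c
  SigR⟨R⟩⇒m₁ = needs⇒received m₂-needs-m₁ ∘ SigR⟨R⟩⇒m₂

  SigR⟨R⟩⇒EOR : val c SigR⟨R⟩ ≡ true → val c EOR ≡ true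
  SigR⟨R⟩⇒EOR = received-sets refl ∘ SigR⟨R⟩⇒m₂

  SigR⟨TTP⟩⇒EOR : val c SigR⟨TTP⟩ ≡ true → val c EOR ≡ true
  SigR⟨TTP⟩⇒EOR = received-sets refl ∘ SigR⟨TTP⟩⇒r₂ᴼ

  SigO⟨TTP⟩⇒EOO : val c SigO⟨TTP⟩ ≡ true → val c EOO ≡ true
  SigO⟨TTP⟩⇒EOO = received-sets refl ∘ SigO⟨TTP⟩⇒r₂ᴿ

  SigR⟨R⟩⇒EOO : val c SigR⟨R⟩ ≡ true → val c EOO ≡ true
  SigR⟨R⟩⇒EOO = received-sets refl ∘ SigR⟨R⟩⇒m₁

  SigR⟨R⟩⇒SigO⟨O⟩ : val c SigR⟨R⟩ ≡ true → val c SigO⟨O⟩ ≡ true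
  SigR⟨R⟩⇒SigO⟨O⟩ = received-sets refl ∘ SigR⟨R⟩⇒m₃

module _ {Sc : Scheduler} {σ : Trace} (tr : ⟦O∥R∥TTP∥ Sc ⟧ σ) where

  -- `σ` agrees with the valuations of the run only pointwise, so the implication is carried over
  -- one variable at a time, at a fixed instant.
  trace-val-⇒ : ∀ {x y} →
                (∀ {c} → Invariant c → val c x ≡ true → val c y ≡ true) →
                ∀ n → σ n x ≡ true → σ n y ≡ true
  trace-val-⇒ {x} {y} x⇒y n p =
    let ρ , σ≡ = tr in
    trans (σ≡ n y) (x⇒y (invariant-run ρ n) (trans (sym (σ≡ n x)) p))

  NRO⇒◇NRR : σ ⊨ φ-O → σ ⊨ □ (NRO ⇒ ◇ NRR)
  NRO⇒◇NRR (_ , □φ) n nro with □φ n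
  -- The instant at which the signature is present also serves for `NRR`, since the evidence `EOR`
  -- holds by then.
  ... | inj₁ (inj₁ (k , sig))       = k , trace-val-⇒ SigR⟨R⟩⇒EOR _ sig , inj₁ sig
  ... | inj₁ (inj₂ ((k , sig) , _)) = k , trace-val-⇒ SigR⟨TTP⟩⇒EOR _ sig , inj₂ sig
  -- Offset 0 is instant `n` itself, where `NRO` already asserts one of the two excluded signatures.
  NRO⇒◇NRR _ n (_ , inj₁ sig) | inj₂ (_ , □¬sig) = ⊥-elim (proj₁ (□¬sig 0) sig)
  NRO⇒◇NRR _ n (_ , inj₂ sig) | inj₂ (_ , □¬sig) = ⊥-elim (proj₂ (□¬sig 0) sig)

  NRR⇒◇NRO : σ ⊨ φ-TTP → σ ⊨ □ (NRR ⇒ ◇ NRO)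
  NRR⇒◇NRO _ n (_ , inj₁ sig) =
    0 , trace-val-⇒ SigR⟨R⟩⇒EOO _ sig , inj₁ (trace-val-⇒ SigR⟨R⟩⇒SigO⟨O⟩ _ sig)
  NRR⇒◇NRO (_ , _ , □SigR⇒◇SigO , _) n (_ , inj₂ sig) =
    let (k , sig′) , _ = □SigR⇒◇SigO n sig in
    k , trace-val-⇒ SigO⟨TTP⟩⇒EOO _ sig′ , inj₂ sig′

theorem1 : ∀ (Sc : Scheduler) → Fair Sc → ∀ (σ : Trace) → ⟦O∥R∥TTP∥ Sc ⟧ σ →
    σ ⊨ φ-O ∧ φ-R ∧ φ-TTP ⇒ φ-f
theorem1 Sc _ σ tr (φo , _ , φttp) = NRO⇒◇NRR tr φo , NRR⇒◇NRO tr φttp
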